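{- For any ${\rm LP}^{\rm MLN}$ program $\mathsf F$ over the signature ${\bf p}$, a set $X\subseteq{\bf p}$ is a soft stable model of $\mathsf F$ if and only if there is no strict subset $Y$ of $X$ such that $Y'\cup X$ satisfies $\Delta_{{\bf p}'}(\{\overline{\mathsf F}\}^{\rm ch})$.
   Context: Let ${\bf p}$ be the propositional signature and ${\bf p}'$ the set of new atoms $p'$, one for each $p\in{\bf p}$. For $Y\subseteq{\bf p}$, $Y'=\{p'\in{\bf p}'\mid p\in Y\}$. Propositional formulas are built from atoms and $\bot$ using $\land,\lor,\rightarrow$, with $\neg F$ standing for $F\rightarrow\bot$ and $\top$ for $\bot\rightarrow\bot$. An interpretation is identified with the set of atoms true in it; $X\models R$ is classical satisfaction. The reduct $F^X$ is obtained from $F$ by replacing every maximal subformula not (classically) satisfied by $X$ with $\bot$; for a set $\Gamma$ of formulas, $\Gamma^X=\{F^X\mid F\in\Gamma\}$. $X$ is a (standard) stable model of $\Gamma$ if $X$ is a minimal model (with respect to inclusion) of $\Gamma^X$. An ${\rm LP}^{\rm MLN}$ program is a finite set of weighted formulas $w:R$, where $R$ is a propositional formula over ${\bf p}$ and $w$ is a real number or the symbol $\alpha$ (infinite weight). $\overline{\mathsf F}$ is the set of formulas obtained from $\mathsf F$ by dropping weights, and $\mathsf F_X$ is the set of those $w:R$ in $\mathsf F$ with $X\models R$. $X$ is a soft stable model of $\mathsf F$ if $X$ is a stable model of $\overline{\mathsf F_X}$. $\{F\}^{\rm ch}$ denotes $F\lor\neg F$, and $\{\Gamma\}^{\rm ch}=\{\{F\}^{\rm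 ch}\mid F\in\Gamma\}$ for a set $\Gamma$ of formulas. For a formula $F$ over ${\bf p}$, $\Delta_{{\bf p}'}(F)$ is defined recursively: $\Delta_{{\bf p}'}(p)=p'$ for atoms $p\in{\bf p}$; $\Delta_{{\bf p}'}(\bot)=\bot$; $\Delta_{{\bf p}'}(\neg F)=\neg F$; $\Delta_{{\bf p}'}(F\land G)=\Delta_{{\bf p}'}(F)\land\Delta_{{\bf p}'}(G)$; $\Delta_{{\bf p}'}(F\lor G)=\Delta_{{\bf p}'}(F)\lor\Delta_{{\bf p}'}(G)$; $\Delta_{{\bf p}'}(F\rightarrow G)=(\Delta_{{\bf p}'}(F)\rightarrow\Delta_{{\bf p}'}(G))\land(F\rightarrow G)$. Applied to a finite set of formulas, $\Delta_{{\bf p}'}$ is applied to the conjunction of its elements (the empty conjunction being $\top$). -}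

module Defs where

open import Data.Bool using (Bool; true; false; T; not; _∧_; _∨_; if_then_else_)
open import Data.Bool.Properties using (T?)
open import Data.Integer using (+_)
open import Data.List using (List; []; _∷_; map; filter)
open import Data.List.Relation.Unary.All using (All)
open import Data.Nat using (ℕ; suc)
open import Data.Product using (_×_; ∃-syntax; _,_; proj₂)
open import Data.Rational using (ℚ; _+_; _-_; _≤_; ∣_∣; _/_)
open import Data.Sum using (_⊎_; inj₁; inj₂)
open import Function using (_∘_)
open import Relation.Nullary using (¬_; Dec)
import Relation.Unary as U

private variable
  A B : Set

infixr 7 _∧ᶠ_
infixr 6 _∨ᶠ_
infixr 5 _→ᶠ_
infix  8 ¬ᶠ_

data Formula (A : Set) : Set where
  atom           : A → Formula A
  ⊥ᶠ             : Formula A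
  _∧ᶠ_ _∨ᶠ_ _→ᶠ_ : Formula A → Formula A → Formula A

¬ᶠ_ : Formula A → Formula A
¬ᶠ F = F →ᶠ ⊥ᶠ

⊤ᶠ : Formula A
⊤ᶠ = ⊥ᶠ →ᶠ ⊥ᶠ

rename : (A → B) → Formula A → Formula B
rename f (atom p)  = atom (f p)
rename f ⊥ᶠ        = ⊥ᶠ
rename f (F ∧ᶠ G)  = rename f F ∧ᶠ rename f G
rename f (F ∨ᶠ G)  = rename f F ∨ᶠ rename f G
rename f (F →ᶠ G)  = rename f F →ᶠ rename f G

-- The set of true atoms, as a characteristic function: Bool-valued so that
-- satisfaction is classical and the reduct is computable.
Interpretation : Set → Set
Interpretation A = A → Bool

infix 4 _⊂_ _⊨_ _⊨?_ _⊨*_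

_⊂_ : Interpretation A → Interpretation A → Set
Y ⊂ X = (T ∘ Y) U.⊂ (T ∘ X)

⟦_⟧ : Formula A → Interpretation A → Bool
⟦ atom p ⟧  X = X p
⟦ ⊥ᶠ ⟧      X = false
⟦ F ∧ᶠ G ⟧  X = ⟦ F ⟧ X ∧ ⟦ G ⟧ X
⟦ F ∨ᶠ G ⟧  X = ⟦ F ⟧ X ∨ ⟦ G ⟧ X
⟦ F →ᶠ G ⟧  X = not (⟦ F ⟧ X) ∨ ⟦ G ⟧ X

_⊨_ : Interpretation A → Formula A → Set
X ⊨ F = T (⟦ F ⟧ X)

_⊨?_ : (X : Interpretation A) (F : Formula A) → Dec (X ⊨ F)
X ⊨? F = T? (⟦ F ⟧ X)

-- Finite sets of formulas are represented by lists; no notion below depends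
-- on order or multiplicity, up to logical equivalence.
_⊨*_ : Interpretation A → List (Formula A) → Set
X ⊨* Γ = All (X ⊨_) Γ

-- Each clause tests the whole formula before descending, so exactly the
-- maximal unsatisfied subformulas are replaced by ⊥ᶠ.
reduct : Interpretation A → Formula A → Formula A
reduct X F@(atom p)  = if ⟦ F ⟧ X then atom p else ⊥ᶠ
reduct X ⊥ᶠ          = ⊥ᶠ
reduct X F@(G ∧ᶠ H)  = if ⟦ F ⟧ X then reduct X G ∧ᶠ reduct X H else ⊥ᶠ
reduct X F@(G ∨ᶠ H)  = if ⟦ F ⟧ X then reduct X G ∨ᶠ reduct X H else ⊥ᶠ
reduct X F@(G →ᶠ H)  = if ⟦ F ⟧ X then reduct X G →ᶠ reduct X H else ⊥ᶠ

MinimalModel : Interpretation A → List (Formula A) → Set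
MinimalModel X Γ = X ⊨* Γ × ¬ (∃[ Y ] (Y ⊂ X × Y ⊨* Γ))

StableModel : Interpretation A → List (Formula A) → Set
StableModel X Γ = MinimalModel X (map (reduct X) Γ)

-- Real numbers as regular Cauchy sequences of rationals (Bishop).
record ℝ : Set where
  field
    seq     : ℕ → ℚ
    regular : ∀ m n → ∣ seq m - seq n ∣ ≤ (+ 1 / suc m) + (+ 1 / suc n)

data Weight : Set where
  real : ℝ → Weight
  α    : Weight

Program : Set → Set
Program A = List (Weight × Formula A)

unweighted : Program A → List (Formula A)
unweighted = map proj₂

satisfiedPart : Program A → Interpretation A → Program A
satisfiedPart 𝔽 X = filter (λ wR → X ⊨? proj₂ wR) 𝔽

SoftStableModel : Interpretation A → Program A → Set
SoftStableModel X 𝔽 = StableModel X (unweighted (satisfiedPart 𝔽 X))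

choice : Formula A → Formula A
choice F = F ∨ᶠ ¬ᶠ F

choice* : List (Formula A) → List (Formula A)
choice* = map choice

⋀ : List (Formula A) → Formula A
⋀ []            = ⊤ᶠ
⋀ (F ∷ [])      = F
⋀ (F ∷ G ∷ Γ)   = F ∧ᶠ ⋀ (G ∷ Γ)

-- The signature p ∪ p′ is A ⊎ A: inj₁ p is the atom p and inj₂ p is p′.
_′∪_ : Interpretation A → Interpretation A → Interpretation (A ⊎ A)
(Y ′∪ X) (inj₁ p) = X p
(Y ′∪ X) (inj₂ p) = Y p

-- Since ¬ F is F → ⊥, the negation clause takes precedence over the
-- general implication clause.
Δ : Formula A → Formula (A ⊎ A)
Δ (atom p)     = atom (inj₂ p)
Δ ⊥ᶠ           = ⊥ᶠ
Δ (F →ᶠ ⊥ᶠ)    = ¬ᶠ rename inj₁ F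
Δ (F ∧ᶠ G)     = Δ F ∧ᶠ Δ G
Δ (F ∨ᶠ G)     = Δ F ∨ᶠ Δ G
Δ (F →ᶠ G)     = (Δ F →ᶠ Δ G) ∧ᶠ rename inj₁ (F →ᶠ G)

Δ* : List (Formula A) → Formula (A ⊎ A)
Δ* Γ = Δ (⋀ Γ)

{-# OPTIONS --safe #-}
-- For Y ⊆ X, evaluating Δ F at Y′ ∪ X is the same as evaluating the reduct F^X
-- at Y. A choice formula F ∨ ¬F contributes F^X when X ⊨ F and nothing otherwise,
-- so the Y ⊂ X satisfying Δ of the choice program are precisely those that refute
-- the minimality of X. That X itself satisfies the reduct is automatic.
module Submission where

open import Data.Bool using (true; false; T; not; _∧_; _∨_)
open import Data.Bool.Properties using (T-∧; ∨-identityʳ; ∨-zeroʳ; ∧-identityʳ; ∧-zeroʳ)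
open import Data.List using (List; []; _∷_; map)
open import Data.List.Relation.Unary.All using (All; []; _∷_)
open import Data.Product using (_×_; ∃-syntax; _,_; proj₁)
open import Data.Sum using (inj₁)
open import Data.Unit using (tt)
open import Function using (_∘_)
open import Function.Bundles using (_⇔_; mk⇔; module Equivalence)
open import Relation.Binary.PropositionalEquality using (_≡_; refl; sym; trans; cong; cong₂; subst)
open import Relation.Nullary using (¬_)
import Relation.Unary as U
open import Defs

open Equivalence using (to; from)

private variable
  A B : Set

⟦rename⟧ : (f : A → B) (I : Interpretation B) (F : Formula A) →
  ⟦ rename f F ⟧ I ≡ ⟦ F ⟧ (I ∘ f)
⟦rename⟧ f I (atom p)  = refl
⟦rename⟧ f I ⊥ᶠ        = refl
⟦rename⟧ f I (F ∧ᶠ G)  = cong₂ _∧_ (⟦rename⟧ f I F) (⟦rename⟧ f I G)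
⟦rename⟧ f I (F ∨ᶠ G)  = cong₂ _∨_ (⟦rename⟧ f I F) (⟦rename⟧ f I G)
⟦rename⟧ f I (F →ᶠ G)  = cong₂ (λ a b → not a ∨ b) (⟦rename⟧ f I F) (⟦rename⟧ f I G)

reduct-⊭ : (X : Interpretation A) (F : Formula A) → ⟦ F ⟧ X ≡ false → reduct X F ≡ ⊥ᶠ
reduct-⊭ X (atom p) eq rewrite eq = refl
reduct-⊭ X ⊥ᶠ       eq            = refl
reduct-⊭ X (F ∧ᶠ G) eq rewrite eq = refl
reduct-⊭ X (F ∨ᶠ G) eq rewrite eq = refl
reduct-⊭ X (F →ᶠ G) eq rewrite eq = refl

-- Only subformulas false in `X` are replaced, and `⊥ᶠ` is false too, so no truth value at `X`
-- changes.
⟦reduct⟧-self : (X : Interpretation A) (F : Formula A) → ⟦ reduct X F ⟧ X ≡ ⟦ F ⟧ X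
⟦reduct⟧-self X (atom p) with X p in eq
... | true  = eq
... | false = refl
⟦reduct⟧-self X ⊥ᶠ = refl
⟦reduct⟧-self X (F ∧ᶠ G) with ⟦ F ∧ᶠ G ⟧ X in eq
... | true  = trans (cong₂ _∧_ (⟦reduct⟧-self X F) (⟦reduct⟧-self X G)) eq
... | false = refl
⟦reduct⟧-self X (F ∨ᶠ G) with ⟦ F ∨ᶠ G ⟧ X in eq
... | true  = trans (cong₂ _∨_ (⟦reduct⟧-self X F) (⟦reduct⟧-self X G)) eq
... | false = refl
⟦reduct⟧-self X (F →ᶠ G) with ⟦ F →ᶠ G ⟧ X in eq
... | true  = trans (cong₂ (λ a b → not a ∨ b) (⟦reduct⟧-self X F) (⟦reduct⟧-self X G)) eq
... | false = refl

⊨*-reduct-self : (X : Interpretation A) (𝔽 : Program A) →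
  X ⊨* map (reduct X) (unweighted (satisfiedPart 𝔽 X))
⊨*-reduct-self X [] = []
⊨*-reduct-self X ((_ , F) ∷ 𝔽) with ⟦ F ⟧ X in eq
... | true  = subst T (sym (trans (⟦reduct⟧-self X F) eq)) tt ∷ ⊨*-reduct-self X 𝔽
... | false = ⊨*-reduct-self X 𝔽

⊨Δ*⇔ : (I : Interpretation _) (Γ : List (Formula A)) →
  I ⊨ Δ* Γ ⇔ All (λ F → I ⊨ Δ F) Γ
-- `Δ ⊤ᶠ` falls under the negation clause and is true everywhere.
⊨Δ*⇔ I []       = mk⇔ (λ _ → []) (λ _ → tt)
⊨Δ*⇔ I (F ∷ []) = mk⇔ (λ h → h ∷ []) λ { (h ∷ []) → h }
⊨Δ*⇔ I (F ∷ Γ@(_ ∷ _)) with ih ← ⊨Δ*⇔ I Γ = mk⇔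
  (λ h → let (hF , hΓ) = to T-∧ h in hF ∷ to ih hΓ)
  λ { (hF ∷ hΓ) → from T-∧ (hF , from ih hΓ) }

module _ (X Y : Interpretation A) (Y⊆X : (T ∘ Y) U.⊆ (T ∘ X)) where

  -- The unprimed conjunct `F →ᶠ G` takes its value at `X`, so it acts as the test made by the
  -- reduct: true leaves the implication between the reducts, false makes the whole false.
  ⟦Δ→⟧ : ∀ F G →
    ⟦ Δ F ⟧ (Y ′∪ X) ≡ ⟦ reduct X F ⟧ Y → ⟦ Δ G ⟧ (Y ′∪ X) ≡ ⟦ reduct X G ⟧ Y →
    ⟦ (Δ F →ᶠ Δ G) ∧ᶠ rename inj₁ (F →ᶠ G) ⟧ (Y ′∪ X) ≡ ⟦ reduct X (F →ᶠ G) ⟧ Y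
  ⟦Δ→⟧ F G ihF ihG rewrite ihF | ihG | ⟦rename⟧ inj₁ (Y ′∪ X) (F →ᶠ G)
    with ⟦ F →ᶠ G ⟧ X
  ... | true  = ∧-identityʳ _
  ... | false = ∧-zeroʳ _

  ⟦Δ⟧≡⟦reduct⟧ : ∀ F → ⟦ Δ F ⟧ (Y ′∪ X) ≡ ⟦ reduct X F ⟧ Y
  ⟦Δ⟧≡⟦reduct⟧ (atom p) with X p | Y p in eq | Y⊆X {p}
  ... | true  | _     | _ = sym eq
  ... | false | false | _ = refl
  -- This is where inclusion enters: an atom of `Y` outside `X` would satisfy `p′` although the
  -- reduct of `p` is `⊥ᶠ`.
  ... | false | true  | h with () ← h tt
  ⟦Δ⟧≡⟦reduct⟧ ⊥ᶠ = refl
  ⟦Δ⟧≡⟦reduct⟧ (F ∧ᶠ G)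
    rewrite ⟦Δ⟧≡⟦reduct⟧ F | ⟦Δ⟧≡⟦reduct⟧ G
    with ⟦ F ⟧ X in eqF | ⟦ G ⟧ X in eqG
  ... | true  | true  = refl
  -- The reduct replaces the whole conjunction by `⊥ᶠ`, while `Δ` keeps it; both are false at `Y`
  -- because the failing conjunct has reduct `⊥ᶠ`.
  ... | true  | false rewrite reduct-⊭ X G eqG = ∧-zeroʳ _
  ... | false | _     rewrite reduct-⊭ X F eqF = refl
  ⟦Δ⟧≡⟦reduct⟧ (F ∨ᶠ G)
    rewrite ⟦Δ⟧≡⟦reduct⟧ F | ⟦Δ⟧≡⟦reduct⟧ G
    with ⟦ F ⟧ X in eqF | ⟦ G ⟧ X in eqG
  ... | true  | _     = refl
  ... | false | true  = refl
  ... | false | false rewrite reduct-⊭ X F eqF | reduct-⊭ X G eqG = refl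
  -- The reduct of a negation is `⊥ᶠ` or `⊥ᶠ →ᶠ ⊥ᶠ`, so its value depends on `X` alone, matching the
  -- unprimed formula kept by `Δ`.
  ⟦Δ⟧≡⟦reduct⟧ (F →ᶠ ⊥ᶠ)
    rewrite ⟦rename⟧ inj₁ (Y ′∪ X) F
    with ⟦ F ⟧ X in eqF
  ... | true  = refl
  ... | false rewrite reduct-⊭ X F eqF = refl
  -- The general clause of `Δ` unfolds only once the head of `G` is known to differ from `⊥ᶠ`, hence
  -- one case per constructor.
  ⟦Δ⟧≡⟦reduct⟧ (F →ᶠ G@(atom _)) = ⟦Δ→⟧ F G (⟦Δ⟧≡⟦reduct⟧ F) (⟦Δ⟧≡⟦reduct⟧ G)
  ⟦Δ⟧≡⟦reduct⟧ (F →ᶠ G@(_ ∧ᶠ _)) = ⟦Δ→⟧ F G (⟦Δ⟧≡⟦reduct⟧ F) (⟦Δ⟧≡⟦reduct⟧ G)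
  ⟦Δ⟧≡⟦reduct⟧ (F →ᶠ G@(_ ∨ᶠ _)) = ⟦Δ→⟧ F G (⟦Δ⟧≡⟦reduct⟧ F) (⟦Δ⟧≡⟦reduct⟧ G)
  ⟦Δ⟧≡⟦reduct⟧ (F →ᶠ G@(_ →ᶠ _)) = ⟦Δ→⟧ F G (⟦Δ⟧≡⟦reduct⟧ F) (⟦Δ⟧≡⟦reduct⟧ G)

  ⟦Δ-choice⟧ : ∀ F → ⟦ Δ (choice F) ⟧ (Y ′∪ X) ≡ ⟦ reduct X F ⟧ Y ∨ not (⟦ F ⟧ X)
  ⟦Δ-choice⟧ F = cong₂ _∨_ (⟦Δ⟧≡⟦reduct⟧ F)
    (trans (∨-identityʳ _) (cong not (⟦rename⟧ inj₁ (Y ′∪ X) F)))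

  ⊨Δ-choices⇔⊨*reduct : ∀ 𝔽 →
    All (λ F → (Y ′∪ X) ⊨ Δ F) (choice* (unweighted 𝔽)) ⇔
    Y ⊨* map (reduct X) (unweighted (satisfiedPart 𝔽 X))
  ⊨Δ-choices⇔⊨*reduct [] = mk⇔ (λ _ → []) (λ _ → [])
  -- The value of `F` at `X` decides both whether the filter keeps `F` and whether the disjunct
  -- `¬ᶠ F` already makes the choice formula true.
  ⊨Δ-choices⇔⊨*reduct ((_ , F) ∷ 𝔽) with ⟦ F ⟧ X | ⟦Δ-choice⟧ F | ⊨Δ-choices⇔⊨*reduct 𝔽
  ... | true  | eq | ih = mk⇔
    (λ { (h ∷ hs) → subst T (trans eq (∨-identityʳ _)) h ∷ to ih hs })
    (λ { (h ∷ hs) → subst T (sym (trans eq (∨-identityʳ _))) h ∷ from ih hs })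
  ... | false | eq | ih = mk⇔
    (λ { (_ ∷ hs) → to ih hs })
    (λ hs → subst T (sym (trans eq (∨-zeroʳ _))) tt ∷ from ih hs)

proposition6 : ∀ {A : Set} (𝔽 : Program A) (X : Interpretation A) →
    SoftStableModel X 𝔽 ⇔ (¬ (∃[ Y ] (Y ⊂ X × (Y ′∪ X) ⊨ Δ* (choice* (unweighted 𝔽)))))
proposition6 𝔽 X = mk⇔
  (λ (_ , minimal) (Y , Y⊂X , h) →
    -- The same `Y` refutes both sides; strictness is passed on unchanged and its inclusion half
    -- feeds the equivalence.
    minimal (Y , Y⊂X , to (⊨Δ-choices⇔⊨*reduct X Y (proj₁ Y⊂X) 𝔽) (to (⊨Δ*⇔ _ _) h)))
  (λ none → ⊨*-reduct-self X 𝔽 , λ (Y , Y⊂X , h) →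
    none (Y , Y⊂X , from (⊨Δ*⇔ _ _) (from (⊨Δ-choices⇔⊨*reduct X Y (proj₁ Y⊂X) 𝔽) h)))
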